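{- Let $G=(V,E)$ be a finite simple undirected graph and let $\sigma$ be the visiting ordering of a maxDFS on $G$. Then $G$ is trivially perfect if and only if $\sigma$ avoids both of the following patterns, i.e. there is no triple of vertices $a<_\sigma b<_\sigma c$ such that (1) $ab\in E$, $bc\in E$ and $ac\notin E$; or (2) $ac\in E$, $bc\in E$ and $ab\notin E$.
   Context: A graph is trivially perfect if it contains neither $C_4$ (cycle on 4 vertices) nor $P_4$ (path on 4 vertices) as an induced subgraph. A maxDFS is a Depth First Search in which ties between eligible vertices are broken by largest degree (degrees in $G$, a fixed priority): the search starts at a vertex of maximum degree, the recursive call is always made on an unvisited neighbour of largest degree of the current vertex (remaining ties broken arbitrarily), and, if the graph is disconnected, the search restarts at an unvisited vertex of largest degree once a component is exhausted. The visiting ordering lists vertices in the order in which they are first visited. -}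

module Defs where

open import Data.Fin.Base as Fin using (Fin; toℕ)
open import Data.Fin.Properties using (all?)
open import Data.Fin.Subset using (Subset; ∣_∣)
open import Data.List.Base using (List; []; _∷ʳ_; lookup)
open import Data.List.Membership.Propositional using (_∈_; _∉_)
open import Data.Nat.Base using (ℕ; suc; _≤_; _%_)
import Data.Nat.Properties as ℕ
open import Data.Product.Base using (_×_; Σ-syntax; ∃-syntax)
open import Data.Sum.Base using (_⊎_; [_,_]; swap)
open import Data.Vec.Base using (tabulate)
open import Function.Bundles using (_⇔_)
open import Function.Definitions using (Injective)
open import Level using (0ℓ)
open import Relation.Binary.Core using (Rel)
open import Relation.Binary.Definitions using (Decidable; Symmetric)
open import Relation.Binary.PropositionalEquality using (_≡_)
open import Relation.Nullary using (¬_; does; ¬?; from-yes; _⊎-dec_)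

-- Decidability of adjacency is what makes degrees computable.
record Graph (n : ℕ) : Set₁ where
  field
    Adj    : Rel (Fin n) 0ℓ
    adj?   : Decidable Adj
    sym    : Symmetric Adj
    irrefl : ∀ v → ¬ Adj v v

  neighbours : Fin n → Subset n
  neighbours v = tabulate λ w → does (adj? v w)

  degree : Fin n → ℕ
  degree v = ∣ neighbours v ∣

open Graph public using (Adj; degree)

symmetrise : ∀ {n} (R : Rel (Fin n) 0ℓ) → Decidable R → (∀ v → ¬ R v v) → Graph n
symmetrise R R? R-irrefl = record
  { Adj    = λ v w → R v w ⊎ R w v
  ; adj?   = λ v w → R? v w ⊎-dec R? w v
  ; sym    = swap
  ; irrefl = λ v → [ R-irrefl v , R-irrefl v ]
  }

P₄ : Graph 4
P₄ = symmetrise (λ i j → suc (toℕ i) ≡ toℕ j) next?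
       (from-yes (all? λ i → ¬? (next? i i)))
  where
  next? : Decidable (λ i j → suc (toℕ {4} i) ≡ toℕ {4} j)
  next? i j = suc (toℕ i) ℕ.≟ toℕ j

C₄ : Graph 4
C₄ = symmetrise (λ i j → suc (toℕ i) % 4 ≡ toℕ j) next?
       (from-yes (all? λ i → ¬? (next? i i)))
  where
  next? : Decidable (λ i j → suc (toℕ {4} i) % 4 ≡ toℕ {4} j)
  next? i j = suc (toℕ i) % 4 ℕ.≟ toℕ j

InducedSubgraph : ∀ {m n} → Graph m → Graph n → Set
InducedSubgraph {m} {n} H G =
  Σ[ f ∈ (Fin m → Fin n) ]
    Injective _≡_ _≡_ f × (∀ v w → Adj H v w ⇔ Adj G (f v) (f w))

TriviallyPerfect : ∀ {n} → Graph n → Set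
TriviallyPerfect G = ¬ InducedSubgraph C₄ G × ¬ InducedSubgraph P₄ G

module _ {n} (G : Graph n) where

  private
    V = Fin n

  -- Each (part of a) run is related to the list of vertices visited before it and
  -- the list visited after it, both in order of first visit.  The choice among
  -- eligible vertices of equal degree is left open, so these are relations.
  -- Visit is the recursive call on a vertex, Extend its loop over neighbours.
  data Visit  : V → List V → List V → Set
  data Extend : V → List V → List V → Set

  data Visit where
    visit : ∀ {v xs ys} → Extend v (xs ∷ʳ v) ys → Visit v xs ys

  data Extend where
    backtrack : ∀ {v xs} → (∀ u → Adj G v u → u ∈ xs) → Extend v xs xs
    descend   : ∀ {v w xs ys zs} →
                Adj G v w → w ∉ xs →
                (∀ u → Adj G v u → u ∉ xs → degree G u ≤ degree G w) →
                Visit w xs ys → Extend v ys zs → Extend v xs zs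

  data Search : List V → List V → Set where
    finish : ∀ {xs} → (∀ u → u ∈ xs) → Search xs xs
    start  : ∀ {w xs ys zs} →
             w ∉ xs → (∀ u → u ∉ xs → degree G u ≤ degree G w) →
             Visit w xs ys → Search ys zs → Search xs zs

  MaxDFS : List V → Set
  MaxDFS σ = Search [] σ

-- v occurs before w in σ.  Occurrences are unique when σ is a visiting ordering,
-- as the search only ever visits unvisited vertices.
_<[_]_ : ∀ {n} → Fin n → List (Fin n) → Fin n → Set
v <[ σ ] w = ∃[ i ] ∃[ j ] i Fin.< j × lookup σ i ≡ v × lookup σ j ≡ w

{-# OPTIONS --safe #-}
-- Every induced path x - m - y puts m before x and y in a pattern-avoiding ordering:
-- the two patterns are the orders in which m comes second or last.  P₄ and C₄ contain
-- induced paths f₀ - f₁ - f₂ and f₁ - f₂ - f₃, whose centres would precede each other.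
-- Conversely, in a trivially perfect graph the centre of an induced path has larger
-- degree than both ends, and a maxDFS never visits x before an adjacent m of larger
-- degree: x is not a root, as m was a better one; and if x is reached from p, then either
-- m was a better choice at p, or p - x - m is an induced path and x has the larger degree.
module Submission where

open import Defs
open import Data.Fin.Base as Fin using (Fin; zero; suc)
open import Data.Fin.Patterns using (0F; 1F; 2F; 3F)
open import Data.Fin.Properties as Fin using (_≟_)
open import Data.Fin.Subset as Subset using (Subset; inside; outside; ∣_∣; _∪_; ⁅_⁆; _-_)
import Data.Fin.Subset.Properties as Subset
open import Data.List.Base using (List; []; _∷_; _∷ʳ_; lookup)
open import Data.List.Membership.Propositional using (_∈_; _∉_)
open import Data.List.Membership.Propositional.Properties using (∈-lookup; ∈-++⁻; ∈-++⁺ˡ; ∈-++⁺ʳ)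
open import Data.List.Relation.Unary.All as All using (All; []; _∷_)
open import Data.List.Relation.Unary.AllPairs as AllPairs using (AllPairs; []; _∷_)
import Data.List.Relation.Unary.AllPairs.Properties as AllPairs
open import Data.List.Relation.Unary.Any using (here; index)
open import Data.List.Relation.Unary.Any.Properties using (lookup-index)
open import Data.List.Relation.Unary.Unique.Propositional using (Unique)
open import Data.Nat.Base using (ℕ; suc; _≤_; _<_; s≤s; s<s⁻¹)
open import Data.Nat.Properties using (module ≤-Reasoning; ≤-refl; <⇒≤; <⇒≱; n≤1+n)
open import Data.Product.Base using (_×_; _,_; proj₁; proj₂; ∃-syntax)
open import Data.Sum.Base using (_⊎_; inj₁; inj₂)
open import Data.Vec.Base using ([]; _∷_)
open import Data.Vec.Properties using (lookup∘tabulate; lookup⇒[]=; []=⇒lookup)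
open import Function.Base using (_∘_; case_of_)
open import Function.Bundles using (_⇔_; mk⇔; Equivalence)
open import Function.Definitions using (Injective)
open import Relation.Binary.Core using (Rel)
open import Relation.Binary.Definitions using (tri<; tri≈; tri>)
open import Relation.Binary.PropositionalEquality using (_≡_; _≢_; refl; sym; trans; cong; subst; ≢-sym)
open import Relation.Nullary using (¬_; does; yes; no; contradiction)
open import Relation.Nullary.Decidable using (dec-true; from-no)

-- Subset sizes and positions in lists.

∣p∪⁅x⁆∣≤1+∣p∣ : ∀ {n} (p : Subset n) x → ∣ p ∪ ⁅ x ⁆ ∣ ≤ suc ∣ p ∣
∣p∪⁅x⁆∣≤1+∣p∣ (outside ∷ p) zero    rewrite Subset.∪-identityʳ p = ≤-refl
∣p∪⁅x⁆∣≤1+∣p∣ (inside  ∷ p) zero    rewrite Subset.∪-identityʳ p = n≤1+n _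
∣p∪⁅x⁆∣≤1+∣p∣ (outside ∷ p) (suc x) = ∣p∪⁅x⁆∣≤1+∣p∣ p x
∣p∪⁅x⁆∣≤1+∣p∣ (inside  ∷ p) (suc x) = s≤s (∣p∪⁅x⁆∣≤1+∣p∣ p x)

AllPairs-lookup : ∀ {a r} {A : Set a} {R : Rel A r} {xs : List A} → AllPairs R xs →
                  ∀ {i j} → i Fin.< j → R (lookup xs i) (lookup xs j)
AllPairs-lookup (Rx ∷ _)  {zero}  {suc j} _   = All.lookup Rx (∈-lookup j)
AllPairs-lookup (_  ∷ Rs) {suc i} {suc j} i<j = AllPairs-lookup Rs (s<s⁻¹ i<j)

Unique⇒lookup-injective : ∀ {a} {A : Set a} {xs : List A} → Unique xs → Injective _≡_ _≡_ (lookup xs)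
Unique⇒lookup-injective xs! {i} {j} eq with Fin.<-cmp i j
... | tri< i<j _ _ = contradiction eq (AllPairs-lookup xs! i<j)
... | tri≈ _ i≡j _ = i≡j
... | tri> _ _ j<i = contradiction (sym eq) (AllPairs-lookup xs! j<i)

SameAdj : ∀ {m n} → Graph m → Graph n → (Fin m → Fin n) → Rel (Fin m) _
SameAdj H G f v w = Adj H v w ⇔ Adj G (f v) (f w)

both : ∀ {A B : Set} → A → B → A ⇔ B
both a b = mk⇔ (λ _ → b) (λ _ → a)

neither : ∀ {A B : Set} → ¬ A → ¬ B → A ⇔ B
neither ¬a ¬b = mk⇔ (λ a → contradiction a ¬a) (λ b → contradiction b ¬b)

-- Adjacency is symmetric and irreflexive on both sides, so checking each unordered pair once is
-- enough.
induced : ∀ {m n} (H : Graph m) (G : Graph n) (f : Fin m → Fin n) →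
          (∀ v w → v Fin.< w → f v ≢ f w × SameAdj H G f v w) → InducedSubgraph H G
induced H G f f-< = f , injective , same
  where
  injective : ∀ {v w} → f v ≡ f w → v ≡ w
  injective {v} {w} fv≡fw with Fin.<-cmp v w
  ... | tri< v<w _ _ = contradiction fv≡fw (proj₁ (f-< v w v<w))
  ... | tri≈ _ v≡w _ = v≡w
  ... | tri> _ _ w<v = contradiction (sym fv≡fw) (proj₁ (f-< w v w<v))

  same : ∀ v w → SameAdj H G f v w
  same v w with Fin.<-cmp v w
  ... | tri< v<w _ _  = proj₂ (f-< v w v<w)
  ... | tri≈ _ refl _ = neither (Graph.irrefl H v) (Graph.irrefl G (f v))
  ... | tri> _ _ w<v  = mk⇔ (Graph.sym G ∘ Equivalence.to e ∘ Graph.sym H)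
                            (Graph.sym H ∘ Equivalence.from e ∘ Graph.sym G)
    where e = proj₂ (f-< w v w<v)

module _ {n} (G : Graph n) where

  private
    V = Fin n
    adj? = Graph.adj? G
    deg = degree G

  adj⇒≢ : ∀ {v w} → Adj G v w → v ≢ w
  adj⇒≢ vw refl = Graph.irrefl G _ vw

  ∈-neighbours⁺ : ∀ {v w} → Adj G v w → w Subset.∈ Graph.neighbours G v
  ∈-neighbours⁺ {v} {w} vw = lookup⇒[]= w _
    (trans (lookup∘tabulate _ w) (dec-true (adj? v w) vw))

  ∈-neighbours⁻ : ∀ {v w} → w Subset.∈ Graph.neighbours G v → Adj G v w
  ∈-neighbours⁻ {v} {w} w∈
    with adj? v w | trans (sym (lookup∘tabulate (λ u → does (adj? v u)) w)) ([]=⇒lookup w∈)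
  ... | yes vw | _  = vw
  ... | no  _  | ()

  -- Induced paths on three vertices.

  record InducedP₃ (x m y : V) : Set where
    field
      xm  : Adj G x m
      my  : Adj G m y
      ¬xy : ¬ Adj G x y
      x≢y : x ≢ y

  module _ (H : Graph 4) where

    -- The two overlapping paths settle every pair but the outer one `a`, `d`. Leaving that pair as
    -- a parameter treats the path and the cycle at once.
    induced₄ : Adj H 0F 1F → Adj H 1F 2F → Adj H 2F 3F → ¬ Adj H 0F 2F → ¬ Adj H 1F 3F →
               ∀ {a b c d} → InducedP₃ a b c → InducedP₃ b c d →
               Adj H 0F 3F ⇔ Adj G a d → InducedSubgraph H G
    induced₄ h01 h12 h23 ¬h02 ¬h13 {a} {b} {c} {d} abc bcd 03⇔ad = induced H G f λ where
        0F 1F _ → adj⇒≢ P.xm , both h01 P.xm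
        0F 2F _ → P.x≢y , neither ¬h02 P.¬xy
        0F 3F _ → a≢d , 03⇔ad
        1F 2F _ → adj⇒≢ P.my , both h12 P.my
        1F 3F _ → Q.x≢y , neither ¬h13 Q.¬xy
        2F 3F _ → adj⇒≢ Q.my , both h23 Q.my
        0F 0F ()
        (suc _) 0F ()
        1F 1F (s≤s ())
        2F 1F (s≤s ())
        3F 1F (s≤s ())
        2F 2F (s≤s (s≤s ()))
        3F 2F (s≤s (s≤s ()))
        3F 3F (s≤s (s≤s (s≤s ())))
      where
      module P = InducedP₃ abc
      module Q = InducedP₃ bcd
      a≢d : a ≢ d
      -- If `d` were `a`, the edge `ab` would join the ends of the path `b`, `c`, `d`.
      a≢d refl = Q.¬xy (Graph.sym G P.xm)
      f : Fin 4 → V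
      f 0F = a
      f 1F = b
      f 2F = c
      f 3F = d

    P₃-image : ∀ {u v w} → Adj H u v → Adj H v w → ¬ Adj H u w → u ≢ w →
               ((f , _) : InducedSubgraph H G) → InducedP₃ (f u) (f v) (f w)
    P₃-image uv vw ¬uw u≢w (_ , injective , same) = record
      { xm  = Equivalence.to (same _ _) uv
      ; my  = Equivalence.to (same _ _) vw
      ; ¬xy = ¬uw ∘ Equivalence.from (same _ _)
      ; x≢y = u≢w ∘ injective
      }

  reverse : ∀ {x m y} → InducedP₃ x m y → InducedP₃ y m x
  reverse p = record
    { xm = Graph.sym G my ; my = Graph.sym G xm ; ¬xy = ¬xy ∘ Graph.sym G ; x≢y = ≢-sym x≢y }
    where open InducedP₃ p

  module _ (tp : TriviallyPerfect G) where

    -- An edge `ad` would close the chain to an induced `C₄`; without it the chain is an induced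
    -- `P₄`.
    ¬P₃-chain : ∀ {a b c d} → InducedP₃ a b c → ¬ InducedP₃ b c d
    ¬P₃-chain {a} {d = d} abc bcd with adj? a d
    ... | yes ad = proj₁ tp (induced₄ C₄ (inj₁ refl) (inj₁ refl) (inj₁ refl)
                     (from-no (Graph.adj? C₄ 0F 2F)) (from-no (Graph.adj? C₄ 1F 3F))
                     -- The closing edge of the cycle runs from 3 to 0 modulo 4, hence `inj₂`.
                     abc bcd (both (inj₂ refl) ad))
    ... | no ¬ad = proj₂ tp (induced₄ P₄ (inj₁ refl) (inj₁ refl) (inj₁ refl)
                     (from-no (Graph.adj? P₄ 0F 2F)) (from-no (Graph.adj? P₄ 1F 3F))
                     abc bcd (neither (from-no (Graph.adj? P₄ 0F 3F)) ¬ad))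

    -- Apart from `m` itself, every neighbour of `x` is a neighbour of `m` other than `x` and `y`.
    -- Two neighbours of `m` are lost against one gained, which makes the inequality strict.
    end-degree<centre-degree : ∀ {x m y} → InducedP₃ x m y → deg x < deg m
    end-degree<centre-degree {x} {m} {y} xmy = begin-strict
      ∣ N x ∣                    ≤⟨ Subset.p⊆q⇒∣p∣≤∣q∣ covered ⟩
      ∣ (N m - x - y) ∪ ⁅ m ⁆ ∣  ≤⟨ ∣p∪⁅x⁆∣≤1+∣p∣ (N m - x - y) m ⟩
      suc ∣ N m - x - y ∣        ≤⟨ Subset.x∈p⇒∣p-x∣<∣p∣ y∈Nm-x ⟩
      ∣ N m - x ∣                <⟨ Subset.x∈p⇒∣p-x∣<∣p∣ (∈-neighbours⁺ (Graph.sym G xm)) ⟩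
      ∣ N m ∣                    ∎
      where
      open InducedP₃ xmy
      open ≤-Reasoning
      N = Graph.neighbours G

      y∈Nm-x : y Subset.∈ N m - x
      y∈Nm-x = Subset.x∈p∧x≢y⇒x∈p-y (∈-neighbours⁺ my) (≢-sym x≢y)

      covered : N x Subset.⊆ (N m - x - y) ∪ ⁅ m ⁆
      covered {z} z∈Nx with z ≟ m | adj? m z
      ... | yes refl | _ = Subset.x∈p∪q⁺ (inj₂ (Subset.x∈⁅x⁆ m))
      ... | no _ | yes mz = Subset.x∈p∪q⁺ (inj₁
            (Subset.x∈p∧x≢y⇒x∈p-y
              (Subset.x∈p∧x≢y⇒x∈p-y (∈-neighbours⁺ mz) (≢-sym (adj⇒≢ (∈-neighbours⁻ z∈Nx))))
              λ { refl → ¬xy (∈-neighbours⁻ z∈Nx) }))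
      -- Here `z`, `x`, `m` is an induced path that chains with `x`, `m`, `y`.
      ... | no z≢m | no ¬mz = contradiction xmy (¬P₃-chain record
            { xm = Graph.sym G (∈-neighbours⁻ z∈Nx) ; my = xm ; ¬xy = ¬mz ∘ Graph.sym G ; x≢y = z≢m })

  -- The invariant of the search.

  MayPrecede : Rel V _
  MayPrecede x u = x ≢ u × (Adj G x u → deg u ≤ deg x)

  -- The second half looks ahead to unvisited vertices, so that whichever of them is visited next
  -- fits after the present list.
  Frontier : List V → Set
  Frontier xs = AllPairs MayPrecede xs × (∀ {x u} → x ∈ xs → u ∉ xs → MayPrecede x u)

  Frontier-[] : Frontier []
  Frontier-[] = [] , λ ()

  Frontier-∷ʳ : ∀ {xs w} → Frontier xs → w ∉ xs → (∀ {u} → u ∉ xs → Adj G w u → deg u ≤ deg w) →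
                Frontier (xs ∷ʳ w)
  Frontier-∷ʳ {xs} {w} (ordered , before) w∉xs maximal =
      AllPairs.++⁺ ordered ([] ∷ []) (All.tabulate λ x∈xs → before x∈xs w∉xs ∷ [])
    , before′
    where
    before′ : ∀ {x u} → x ∈ xs ∷ʳ w → u ∉ xs ∷ʳ w → MayPrecede x u
    before′ x∈ u∉ with ∈-++⁻ xs x∈
    ... | inj₁ x∈xs        = before x∈xs (u∉ ∘ ∈-++⁺ˡ)
    ... | inj₂ (here refl) = (λ { refl → u∉ x∈ }) , maximal (u∉ ∘ ∈-++⁺ˡ)

  Search-complete : ∀ {xs σ} → Search G xs σ → ∀ u → u ∈ σ
  Search-complete (finish all∈)   = all∈
  Search-complete (start _ _ _ s) = Search-complete s

  Visit-⊆  : ∀ {v xs ys u} → Visit G v xs ys → u ∈ xs → u ∈ ys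
  Extend-⊆ : ∀ {v xs ys u} → Extend G v xs ys → u ∈ xs → u ∈ ys
  Visit-⊆ (visit e) u∈ = Extend-⊆ e (∈-++⁺ˡ u∈)
  Extend-⊆ (backtrack _)       u∈ = u∈
  Extend-⊆ (descend _ _ _ r e) u∈ = Extend-⊆ e (Visit-⊆ r u∈)

  module _ (tp : TriviallyPerfect G) where

    -- A visit assumes the invariant with `v` already appended, since the reason why `v` was a good
    -- choice is known only to the caller.
    Visit-frontier  : ∀ {v xs ys} → Visit G v xs ys → Frontier (xs ∷ʳ v) → Frontier ys
    Extend-frontier : ∀ {v xs ys} → Extend G v xs ys → v ∈ xs → Frontier xs → Frontier ys
    Visit-frontier {xs = xs} (visit e) = Extend-frontier e (∈-++⁺ʳ xs (here refl))
    Extend-frontier (backtrack _) _ fr = fr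
    Extend-frontier {v} {xs} (descend {w = w} vw w∉xs maximal r e) v∈xs fr =
      Extend-frontier e (Visit-⊆ r v∈xs) (Visit-frontier r (Frontier-∷ʳ fr w∉xs maximal′))
      where
      maximal′ : ∀ {u} → u ∉ xs → Adj G w u → deg u ≤ deg w
      -- Either `u` competed with `w` in the choice made at `v`, or `v`, `w`, `u` is an induced path
      -- with centre `w`.
      maximal′ {u} u∉xs wu with adj? v u
      ... | yes vu = maximal u vu u∉xs
      ... | no ¬vu = <⇒≤ (end-degree<centre-degree tp (reverse record
            { xm = vw ; my = wu ; ¬xy = ¬vu ; x≢y = λ { refl → u∉xs v∈xs } }))

    Search-ordered : ∀ {xs σ} → Search G xs σ → Frontier xs → AllPairs MayPrecede σ
    Search-ordered (finish _) fr = proj₁ fr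
    Search-ordered (start w∉xs maximal r s) fr =
      Search-ordered s (Visit-frontier r (Frontier-∷ʳ fr w∉xs λ {u} u∉xs _ → maximal u u∉xs))

  -- The two directions of the equivalence.

  HasPattern : List V → Set
  HasPattern σ = ∃[ a ] ∃[ b ] ∃[ c ] (a <[ σ ] b) × (b <[ σ ] c) ×
    ((Adj G a b × Adj G b c × ¬ Adj G a c) ⊎
     (Adj G a c × Adj G b c × ¬ Adj G a b))

  -- In either pattern `a` is an end of an induced path whose centre, `b` or `c`, comes later. That
  -- centre has larger degree than its neighbour `a`, against the order of `σ`.
  triviallyPerfect⇒avoids : ∀ {σ} → MaxDFS G σ → TriviallyPerfect G → ¬ HasPattern σ
  triviallyPerfect⇒avoids {σ} dfs tp (a , b , c , a<b , b<c , edges) = case edges of λ where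
      (inj₁ (ab , bc , ¬ac)) → ¬end<centre
        record { xm = ab ; my = bc ; ¬xy = ¬ac ; x≢y = ≢-of (<-trans a<b b<c) } a<b
      (inj₂ (ac , bc , ¬ab)) → ¬end<centre
        record { xm = ac ; my = Graph.sym G bc ; ¬xy = ¬ab ; x≢y = ≢-of a<b } (<-trans a<b b<c)
    where
    ordered : AllPairs MayPrecede σ
    ordered = Search-ordered tp dfs Frontier-[]

    ≢-of : ∀ {v w} → v <[ σ ] w → v ≢ w
    ≢-of (i , j , i<j , refl , refl) = proj₁ (AllPairs-lookup ordered i<j)

    <-trans : ∀ {u v w} → u <[ σ ] v → v <[ σ ] w → u <[ σ ] w
    <-trans (i , j , i<j , ui , vj) (k , l , k<l , vk , wl) = i , l , i<l , ui , wl
      where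
      -- The two hypotheses bring separate positions of `v`; they agree because the distinctness in
      -- `MayPrecede` makes `σ` free of repetitions.
      j≡k : j ≡ k
      j≡k = Unique⇒lookup-injective (AllPairs.map proj₁ ordered) (trans vj (sym vk))
      i<l = Fin.<-trans i<j (subst (Fin._< l) (sym j≡k) k<l)

    ¬end<centre : ∀ {x m y} → InducedP₃ x m y → ¬ (x <[ σ ] m)
    ¬end<centre xmy (i , j , i<j , refl , refl) =
      <⇒≱ (end-degree<centre-degree tp xmy)
          (proj₂ (AllPairs-lookup ordered i<j) (InducedP₃.xm xmy))

  avoids⇒triviallyPerfect : ∀ {σ} → (∀ v → v ∈ σ) → ¬ HasPattern σ → TriviallyPerfect G
  avoids⇒triviallyPerfect {σ} complete avoids =
      (λ sub → centres-clash
        (P₃-image C₄ (inj₁ refl) (inj₁ refl) (from-no (Graph.adj? C₄ 0F 2F)) (λ ()) sub)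
        (P₃-image C₄ (inj₁ refl) (inj₁ refl) (from-no (Graph.adj? C₄ 1F 3F)) (λ ()) sub))
    , (λ sub → centres-clash
        (P₃-image P₄ (inj₁ refl) (inj₁ refl) (from-no (Graph.adj? P₄ 0F 2F)) (λ ()) sub)
        (P₃-image P₄ (inj₁ refl) (inj₁ refl) (from-no (Graph.adj? P₄ 1F 3F)) (λ ()) sub))
    where
    -- Completeness supplies one chosen occurrence of each vertex; distinct vertices get distinct
    -- positions.
    position : V → Fin _
    position = index ∘ complete

    <-position : ∀ {v w} → position v Fin.< position w → v <[ σ ] w
    <-position {v} {w} p<q =
      _ , _ , p<q , sym (lookup-index (complete v)) , sym (lookup-index (complete w))

    compare : ∀ v w → v ≢ w → position v Fin.< position w ⊎ position w Fin.< position v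
    compare v w v≢w with Fin.<-cmp (position v) (position w)
    ... | tri< p<q _ _ = inj₁ p<q
    ... | tri> _ _ q<p = inj₂ q<p
    ... | tri≈ _ p≡q _ = contradiction
          (trans (lookup-index (complete v)) (trans (cong (lookup σ) p≡q) (sym (lookup-index (complete w))))) v≢w

    centre-first : ∀ {x m y} → InducedP₃ x m y → position m Fin.< position x
    centre-first {x} {m} {y} xmy = case compare m x (≢-sym (adj⇒≢ xm)) of λ where
        (inj₁ m<x) → m<x
        -- With `x` before `m`, a later `y` gives the first pattern. Otherwise `m` is last of the
        -- three and the second pattern appears, whichever end comes first.
        (inj₂ x<m) → case compare m y (adj⇒≢ my) , compare x y x≢y of λ where
          (inj₁ m<y , _) → contradiction
            (x , m , y , <-position x<m , <-position m<y , inj₁ (xm , my , ¬xy)) avoids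
          (inj₂ y<m , inj₁ x<y) → contradiction
            (x , y , m , <-position x<y , <-position y<m , inj₂ (xm , Graph.sym G my , ¬xy)) avoids
          (inj₂ y<m , inj₂ y<x) → contradiction
            (y , x , m , <-position y<x , <-position x<m , inj₂ (Graph.sym G my , xm , ¬xy ∘ Graph.sym G)) avoids
      where open InducedP₃ xmy

    centres-clash : ∀ {a b c d} → InducedP₃ a b c → ¬ InducedP₃ b c d
    -- The first path puts `b` before its end `c`, the second puts `c` before its end `b`.
    centres-clash abc bcd = Fin.<-asym (centre-first (reverse abc)) (centre-first bcd)

proposition4 : ∀ (n : ℕ) (G : Graph n) (σ : List (Fin n)) → MaxDFS G σ →
    TriviallyPerfect G ⇔
    (¬ (∃[ a ] ∃[ b ] ∃[ c ] (a <[ σ ] b) × (b <[ σ ] c) ×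
    ((Adj G a b × Adj G b c × ¬ Adj G a c) ⊎
    (Adj G a c × Adj G b c × ¬ Adj G a b))))
proposition4 n G σ dfs =
  mk⇔ (triviallyPerfect⇒avoids G dfs) (avoids⇒triviallyPerfect G (Search-complete G dfs))
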